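{- Let $M,N,S$ be positive integers, and let $Q$ denote the I/O complexity (minimum number of Load moves over all complete red-white pebble games with $S$ red pebbles) of the CDAG of the Modified Gram-Schmidt program below applied to an $M\times N$ matrix $A$. Then $$\frac{M^2N(N-1)}{8(S+M)} \leq Q .$$ Furthermore, if $S\leq M$, then also $$\frac{(M-S)N(N-1)}{4}\leq Q .$$
   Context: Program (Modified Gram-Schmidt, right-looking), with input $M\times N$ array $A$, output arrays $Q$ ($M\times N$) and $R$ ($N\times N$), and scalar $nrm$: for k = 0,...,N-1: nrm = 0.0 for i = 0,...,M-1: nrm += A[i][k]*A[i][k] R[k][k] = sqrt(nrm) for i = 0,...,M-1: Q[i][k] = A[i][k] / R[k][k] for j = k+1,...,N-1: R[k][j] = 0.0 for i = 0,...,M-1: R[k][j] += Q[i][k]*A[i][j] for i = 0,...,M-1: A[i][j] = A[i][j] - Q[i][k]*R[k][j] CDAG of a program: a directed acyclic graph whose nodes are the input values (initial values of array entries read before being written) and the statement instances (each execution of an assignment statement, including compound assignments such as +=), with an edge $u\to v$ whenever the instance $v$ reads a value produced by $u$ (flow dependence). Input nodes have no incoming edges. Red-white pebble game with $S$ red pebbles on a CDAG: initially only the input nodes carry white pebbles and there are no red pebbles. Allowed moves: (Spill) remove a red pebble from a node; (Compute) if a node has no white pebble and all its predecessors carry red pebbles, place a white and a red pebble on it; (Load) place a red pebble on a node carrying a white pebble. At no time may more than $S$ red pebbles be on the graph. The game is complete when every node carries a white pebble. (White pebbles are never removed, so no recomputation.) The I/O complexity $Q$ is the minimum, over all complete games,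 of the number of Load moves. -}

module Defs where

open import Data.Nat using (ℕ; zero; suc; _+_; _*_; _∸_; _≤_; _<_)
open import Data.Product using (_×_; Σ; ∃; _,_; proj₁)
open import Data.Sum using (_⊎_)
open import Data.Unit using (⊤)
open import Data.Empty using (⊥)
open import Data.List using (List; []; _∷_; length)
open import Data.List.Membership.Propositional using (_∈_)
open import Relation.Nullary using (¬_)
open import Relation.Binary.PropositionalEquality using (_≡_; _≢_)

record CDAG : Set₁ where
  field
    V     : Set
    _⇒_   : V → V → Set
    Input : V → Set

record Config (V : Set) : Set₁ where
  constructor conf
  field
    red   : V → Set
    white : V → Set
open Config public

AtMost : {V : Set} → ℕ → (V → Set) → Set
AtMost {V} S P = Σ (List V) λ l → (length l ≤ S) × (∀ v → P v → v ∈ l)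

data Move (V : Set) : Set where
  spill   : V → Move V
  compute : V → Move V
  load    : V → Move V

module Game (G : CDAG) where
  open CDAG G

  initial : Config V
  initial = conf (λ _ → ⊥) Input

  Legal : Move V → Config V → Set
  Legal (spill v)   c = red c v
  Legal (compute v) c = ¬ white c v × (∀ u → u ⇒ v → red c u)
  Legal (load v)    c = white c v

  apply : Move V → Config V → Config V
  apply (spill v)   c = conf (λ w → red c w × w ≢ v) (white c)
  apply (compute v) c = conf (λ w → red c w ⊎ w ≡ v) (λ w → white c w ⊎ w ≡ v)
  apply (load v)    c = conf (λ w → red c w ⊎ w ≡ v) (white c)

  run : Config V → List (Move V) → Config V
  run c []       = c
  run c (m ∷ ms) = run (apply m c) ms

  LegalRun : ℕ → Config V → List (Move V) → Set
  LegalRun S c []       = ⊤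
  LegalRun S c (m ∷ ms) = Legal m c × AtMost S (red (apply m c)) × LegalRun S (apply m c) ms

  CompleteGame : ℕ → List (Move V) → Set
  CompleteGame S ms = LegalRun S initial ms × (∀ v → white (run initial ms) v)

  loads : List (Move V) → ℕ
  loads []             = 0
  loads (load _ ∷ ms)  = suc (loads ms)
  loads (spill _ ∷ ms) = loads ms
  loads (compute _ ∷ ms) = loads ms

-- The CDAG of Modified Gram-Schmidt (right-looking) on an M×N matrix

data MGSNode : Set where
  inA    : (i j : ℕ) → MGSNode
  nrm0   : (k : ℕ) → MGSNode        -- nrm = 0.0                      (iteration k)
  nrmAcc : (k i : ℕ) → MGSNode      -- nrm += A[i][k]*A[i][k]
  rDiag  : (k : ℕ) → MGSNode        -- R[k][k] = sqrt(nrm)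
  qDiv   : (k i : ℕ) → MGSNode      -- Q[i][k] = A[i][k] / R[k][k]
  r0     : (k j : ℕ) → MGSNode      -- R[k][j] = 0.0                  (j > k)
  rAcc   : (k j i : ℕ) → MGSNode    -- R[k][j] += Q[i][k]*A[i][j]
  aUpd   : (k j i : ℕ) → MGSNode    -- A[i][j] = A[i][j] - Q[i][k]*R[k][j]

MGSValid : ℕ → ℕ → MGSNode → Set
MGSValid M N (inA i j)      = i < M × j < N
MGSValid M N (nrm0 k)       = k < N
MGSValid M N (nrmAcc k i)   = k < N × i < M
MGSValid M N (rDiag k)      = k < N
MGSValid M N (qDiv k i)     = k < N × i < M
MGSValid M N (r0 k j)       = k < j × j < N
MGSValid M N (rAcc k j i)   = k < j × j < N × i < M
MGSValid M N (aUpd k j i)   = k < j × j < N × i < M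

-- the node producing the value of A[i][j] read during iteration k
curA : ℕ → ℕ → ℕ → MGSNode
curA zero    i j = inA i j
curA (suc k) i j = aUpd k j i

-- flow dependences (M is needed for "the last accumulation", i = M-1)
data MGSEdge (M : ℕ) : MGSNode → MGSNode → Set where
  nrm-init : ∀ {k}     → MGSEdge M (nrm0 k) (nrmAcc k 0)
  nrm-prev : ∀ {k i}   → MGSEdge M (nrmAcc k i) (nrmAcc k (suc i))
  nrm-A    : ∀ {k i}   → MGSEdge M (curA k i k) (nrmAcc k i)
  rdiag    : ∀ {k}     → MGSEdge M (nrmAcc k (M ∸ 1)) (rDiag k)
  q-A      : ∀ {k i}   → MGSEdge M (curA k i k) (qDiv k i)
  q-R      : ∀ {k i}   → MGSEdge M (rDiag k) (qDiv k i)
  racc-init : ∀ {k j}  → MGSEdge M (r0 k j) (rAcc k j 0)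
  racc-prev : ∀ {k j i} → MGSEdge M (rAcc k j i) (rAcc k j (suc i))
  racc-Q   : ∀ {k j i} → MGSEdge M (qDiv k i) (rAcc k j i)
  racc-A   : ∀ {k j i} → MGSEdge M (curA k i j) (rAcc k j i)
  upd-A    : ∀ {k j i} → MGSEdge M (curA k i j) (aUpd k j i)
  upd-Q    : ∀ {k j i} → MGSEdge M (qDiv k i) (aUpd k j i)
  upd-R    : ∀ {k j i} → MGSEdge M (rAcc k j (M ∸ 1)) (aUpd k j i)

IsInputNode : MGSNode → Set
IsInputNode (inA _ _) = ⊤
IsInputNode _         = ⊥

MGS : ℕ → ℕ → CDAG
MGS M N = record
  { V     = Σ MGSNode (MGSValid M N)
  ; _⇒_   = λ u v → MGSEdge M (proj₁ u) (proj₁ v)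
  ; Input = λ v → IsInputNode (proj₁ v)
  }

{-# OPTIONS --safe #-}
module Submission where

-- Cut a game into segments and let E be the set of nodes computed in a segment. An operand of a node
-- of E lies in E, is red when the segment starts, or is loaded during it, so following A[i][j] back in
-- time charges each update a(k,j,i) of E to one of at most x = (initial reds) + (loads) matrix entries.
-- For fixed (j,i), the k with a(k,j,i) in E form an interval. By the hourglass
-- a(k-1,j,·) → r(k,j) → a(k,j,·), for every interior k of this interval E contains the whole of
-- a(k,j,·), so that columns k and j are charged in all M rows. With f fully charged columns, M f ≤ x
-- and E contains at most x (2 + max(f - 1, 0)) updates. The first segment starts without red pebbles
-- and has fewer than 2T loads; every other one has exactly T. Taking T = S gives the first bound;
-- T = M - S gives x < 2M, hence f ≤ 1, and the second.

open import Defs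
open import Data.Nat using (ℕ; zero; suc; _+_; _*_; _∸_; _≤_; _<_; z≤n; s≤s; z<s; _≤?_; _<?_)
open import Data.Nat.Properties
open import Data.Nat.Induction using (<-rec)
open import Data.Nat.ListAction using (sum)
open import Data.Nat.ListAction.Properties using (sum-++)
open import Data.Nat.Tactic.RingSolver using (solve-∀)
open import Data.Product using (_×_; ∃; ∃₂; _,_; proj₁; proj₂)
open import Data.Product.Properties using (≡-dec)
open import Data.Sum using (_⊎_; inj₁; inj₂)
open import Data.Empty using (⊥-elim)
open import Data.Unit using (tt)
open import Data.List using (List; []; _∷_; [_]; length; map; filter; _++_; upTo; applyUpTo; cartesianProduct)
open import Data.List.Properties using (length-++; length-map; length-applyUpTo; length-upTo; map-++; upTo-∷ʳ)
open import Data.List.Membership.Propositional using (_∈_)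
open import Data.List.Membership.Propositional.Properties
  using (∈-∃++; ∈-++⁺ˡ; ∈-++⁺ʳ; ∈-++⁻; ∈-map⁺; ∈-filter⁺; ∈-filter⁻; ∈-upTo⁺; ∈-upTo⁻; ∈-applyUpTo⁻; ∈-cartesianProduct⁻)
open import Data.List.Relation.Unary.All as All using (All; []; _∷_)
open import Data.List.Relation.Unary.AllPairs using ([]; _∷_)
open import Data.List.Relation.Unary.Any using (here; there)
open import Data.List.Relation.Unary.Unique.Propositional using (Unique)
import Data.List.Relation.Unary.Unique.Propositional.Properties as Unique
import Data.List.Membership.DecPropositional as DecMembership
open import Function using (id; _∘_)
open import Relation.Binary.Definitions using (DecidableEquality)
open import Relation.Binary.PropositionalEquality using (_≡_; _≢_; refl; sym; trans; cong; cong₂; subst; module ≡-Reasoning)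
open import Relation.Nullary using (¬_; Dec; yes; no; contradiction)
open import Relation.Nullary.Decidable using (map′; _×-dec_; _⊎-dec_)
open import Relation.Unary using (Decidable)

-- Counting in lists, sums and heights of predicates

unique-⊆⇒length≤ : {A : Set} {xs ys : List A} → Unique xs → (∀ {x} → x ∈ xs → x ∈ ys) → length xs ≤ length ys
unique-⊆⇒length≤ {xs = []} [] sub = z≤n
unique-⊆⇒length≤ {xs = x ∷ xs} (x∉xs ∷ uniq) sub with ∈-∃++ (sub (here refl))
... | as , bs , refl = begin
  suc (length xs)               ≤⟨ s≤s (unique-⊆⇒length≤ uniq sub′) ⟩
  suc (length (as ++ bs))       ≡⟨ cong suc (length-++ as) ⟩
  suc (length as + length bs)   ≡⟨ sym (+-suc (length as) (length bs)) ⟩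
  length as + suc (length bs)   ≡⟨ sym (length-++ as) ⟩
  length (as ++ x ∷ bs)         ∎
  where
  open ≤-Reasoning
  sub′ : ∀ {y} → y ∈ xs → y ∈ as ++ bs
  sub′ y∈xs with ∈-++⁻ as (sub (there y∈xs))
  ... | inj₁ y∈as         = ∈-++⁺ˡ y∈as
  ... | inj₂ (here refl)  = contradiction refl (All.lookup x∉xs y∈xs)
  ... | inj₂ (there y∈bs) = ∈-++⁺ʳ as y∈bs

length-cartesianProduct : {A B : Set} (xs : List A) (ys : List B) →
                          length (cartesianProduct xs ys) ≡ length xs * length ys
length-cartesianProduct []       ys = refl
length-cartesianProduct (x ∷ xs) ys = trans (length-++ (map (x ,_) ys))
  (cong₂ _+_ (length-map (x ,_) ys) (length-cartesianProduct xs ys))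

-- In `total-growth`, `P` is membership in `H`: only charged entries gain updates, and none gains
-- more than `m`.
sum-map-≤ : {A : Set} {P : A → Set} (P? : Decidable P) (f g : A → ℕ) (m : ℕ) (xs : List A) →
            (∀ {x} → x ∈ xs → f x ≤ g x + m) → (∀ {x} → x ∈ xs → ¬ P x → f x ≤ g x) →
            sum (map f xs) ≤ sum (map g xs) + length (filter P? xs) * m
sum-map-≤ P? f g m []       big small = z≤n
sum-map-≤ P? f g m (x ∷ xs) big small
  with ih ← sum-map-≤ P? f g m xs (big ∘ there) (small ∘ there) | P? x
... | yes _ = ≤-trans (+-mono-≤ (big (here refl)) ih)
                (≤-reflexive (rearrange (g x) m (sum (map g xs)) (length (filter P? xs))))
  where
  rearrange : ∀ a b c d → (a + b) + (c + d * b) ≡ a + c + (b + d * b)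
  rearrange = solve-∀
... | no ¬p = ≤-trans (+-mono-≤ (small (here refl) ¬p) ih)
                (≤-reflexive (sym (+-assoc (g x) _ _)))

-- Column `j` receives `j` updates in each row, so over `upTo N` and `upTo M` this counts all
-- updates of the program.
sum-map-proj₁ : {B : Set} (xs : List ℕ) (ys : List B) →
                sum (map proj₁ (cartesianProduct xs ys)) ≡ sum xs * length ys
sum-map-proj₁ []       ys = refl
sum-map-proj₁ {B} (x ∷ xs) ys = begin
  sum (map proj₁ (map (x ,_) ys ++ cartesianProduct xs ys))
    ≡⟨ cong sum (map-++ proj₁ (map (x ,_) ys) (cartesianProduct xs ys)) ⟩
  sum (map proj₁ (map (x ,_) ys) ++ map proj₁ (cartesianProduct xs ys))
    ≡⟨ sum-++ (map proj₁ (map (x ,_) ys)) (map proj₁ (cartesianProduct xs ys)) ⟩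
  sum (map proj₁ (map (x ,_) ys)) + sum (map proj₁ (cartesianProduct xs ys))
    ≡⟨ cong₂ _+_ (const-row ys) (sum-map-proj₁ xs ys) ⟩
  x * length ys + sum xs * length ys
    ≡⟨ sym (*-distribʳ-+ (length ys) x (sum xs)) ⟩
  (x + sum xs) * length ys ∎
  where
  open ≡-Reasoning
  const-row : (zs : List B) → sum (map proj₁ (map (x ,_) zs)) ≡ x * length zs
  const-row []       = sym (*-zeroʳ x)
  const-row (z ∷ zs) = trans (cong (x +_) (const-row zs)) (sym (*-suc x (length zs)))

2*sum-upTo : ∀ n → 2 * sum (upTo n) ≡ n * (n ∸ 1)
2*sum-upTo zero    = refl
2*sum-upTo (suc n) = begin
  2 * sum (upTo (suc n))              ≡⟨ cong (λ l → 2 * sum l) (sym (upTo-∷ʳ n)) ⟩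
  2 * sum (upTo n ++ [ n ])           ≡⟨ cong (2 *_) (sum-++ (upTo n) [ n ]) ⟩
  2 * (sum (upTo n) + (n + 0))        ≡⟨ *-distribˡ-+ 2 (sum (upTo n)) (n + 0) ⟩
  2 * sum (upTo n) + 2 * (n + 0)      ≡⟨ cong (_+ 2 * (n + 0)) (2*sum-upTo n) ⟩
  n * (n ∸ 1) + 2 * (n + 0)           ≡⟨ gauss n ⟩
  suc n * n                           ∎
  where
  open ≡-Reasoning
  gauss : ∀ n → n * (n ∸ 1) + 2 * (n + 0) ≡ suc n * n
  gauss zero    = refl
  gauss (suc n) = poly n
    where
    poly : ∀ n → suc n * n + 2 * (suc n + 0) ≡ suc (suc n) * suc n
    poly = solve-∀

sum-map-mono : {A : Set} (f g : A → ℕ) (xs : List A) → (∀ {x} → x ∈ xs → f x ≤ g x) →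
               sum (map f xs) ≤ sum (map g xs)
sum-map-mono f g []       le = z≤n
sum-map-mono f g (x ∷ xs) le = +-mono-≤ (le (here refl)) (sum-map-mono f g xs (le ∘ there))

sum-map-zero : {A : Set} (f : A → ℕ) (xs : List A) → (∀ x → f x ≡ 0) → sum (map f xs) ≡ 0
sum-map-zero f []       z = refl
sum-map-zero f (x ∷ xs) z rewrite z x = sum-map-zero f xs z

-- For a downward closed `P` this is the number of `k < n` with `P k`; an interval of newly
-- satisfied `k` then has the difference of two heights as its length.
height : {P : ℕ → Set} → Decidable P → ℕ → ℕ
height P? zero = zero
height P? (suc n) with P? n
... | yes _ = suc n
... | no  _ = height P? n

<height : {P : ℕ → Set} (P? : Decidable P) {n k : ℕ} → k < n → P k → k < height P? n
<height P? {suc n} k<1+n pk with P? n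
... | yes _ = k<1+n
... | no ¬p = <height P? (≤∧≢⇒< (≤-pred k<1+n) λ { refl → ¬p pk }) pk

downward : {P : ℕ → Set} → (∀ k → P (suc k) → P k) → ∀ {k n} → k ≤ n → P n → P k
downward {P} closed {k} k≤n pn with m≤n⇒∃[o]m+o≡n k≤n
... | d , refl = go d pn
  where
  go : ∀ d → P (k + d) → P k
  go zero    p = subst P (+-identityʳ k) p
  go (suc d) p = go d (closed _ (subst P (+-suc k d) p))

<height⇒P : {P : ℕ → Set} (P? : Decidable P) → (∀ k → P (suc k) → P k) →
            ∀ {n k} → k < height P? n → P k
<height⇒P P? closed {suc n} k<h with P? n
... | yes p = downward closed (≤-pred k<h) p
... | no  _ = <height⇒P P? closed {n} k<h

height-empty : {P : ℕ → Set} (P? : Decidable P) → (∀ k → ¬ P k) → ∀ n → height P? n ≡ 0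
height-empty P? ¬p zero = refl
height-empty P? ¬p (suc n) with P? n
... | yes p = ⊥-elim (¬p n p)
... | no  _ = height-empty P? ¬p n

-- Pebble games on an arbitrary CDAG

module Pebbling (G : CDAG) (_≟_ : DecidableEquality (CDAG.V G))
                (Input? : Decidable (CDAG.Input G))
                (input-source : ∀ {u v} → CDAG.Input G v → ¬ CDAG._⇒_ G u v) where
  open CDAG G
  open Game G

  -- Invariants of reachable configurations. Decidability is carried along because `white` is an
  -- arbitrary predicate; `white-closed` survives a computation because the operands are red, hence
  -- already white.
  record Sound (c : Config V) : Set where
    field
      white?       : Decidable (white c)
      red⊆white    : ∀ {v} → red c v → white c v
      white-closed : ∀ {u v} → u ⇒ v → white c v → white c u
      input-white  : ∀ {v} → Input v → white c v
  open Sound public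

  initial-sound : Sound initial
  initial-sound = record
    { white? = Input? ; red⊆white = λ () ; input-white = id
    ; white-closed = λ e inp → ⊥-elim (input-source inp e) }

  apply-sound : ∀ m {c} → Legal m c → Sound c → Sound (apply m c)
  apply-sound (spill v) _ s = record
    { white? = white? s ; red⊆white = red⊆white s ∘ proj₁
    ; white-closed = white-closed s ; input-white = input-white s }
  apply-sound (compute v) (_ , preds) s = record
    { white? = λ w → white? s w ⊎-dec (w ≟ v)
    ; red⊆white = λ { (inj₁ r) → inj₁ (red⊆white s r) ; (inj₂ eq) → inj₂ eq }
    ; white-closed = λ { e (inj₁ w) → inj₁ (white-closed s e w)
                       ; e (inj₂ refl) → inj₁ (red⊆white s (preds _ e)) }
    ; input-white = inj₁ ∘ input-white s }
  apply-sound (load v) w s = record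
    { white? = white? s
    ; red⊆white = λ { (inj₁ r) → red⊆white s r ; (inj₂ refl) → w }
    ; white-closed = white-closed s ; input-white = input-white s }

  run-sound : ∀ {S} ms {c} → LegalRun S c ms → Sound c → Sound (run c ms)
  run-sound []       _               s = s
  run-sound (m ∷ ms) (l , _ , legal) s = run-sound ms legal (apply-sound m l s)

  run-red : ∀ {S} ms {c} → LegalRun S c ms → AtMost S (red c) → AtMost S (red (run c ms))
  run-red []       _                 few = few
  run-red (m ∷ ms) (_ , few , legal) _   = run-red ms legal few

  run-++ : ∀ as bs {c} → run c (as ++ bs) ≡ run (run c as) bs
  run-++ []       bs = refl
  run-++ (m ∷ as) bs = run-++ as bs

  LegalRun-++⁻ : ∀ {S} as bs {c} → LegalRun S c (as ++ bs) → LegalRun S c as × LegalRun S (run c as) bs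
  LegalRun-++⁻ []       bs legal             = tt , legal
  LegalRun-++⁻ (m ∷ as) bs (l , few , legal) with LegalRun-++⁻ as bs legal
  ... | legalˡ , legalʳ = (l , few , legalˡ) , legalʳ

  split-loads : ∀ a ms → a ≤ loads ms → ∃₂ λ as bs → ms ≡ as ++ bs × loads as ≡ a × loads as + loads bs ≡ loads ms
  split-loads zero    ms a≤ = [] , ms , refl , refl , refl
  split-loads (suc a) (spill v ∷ ms) a≤ with split-loads (suc a) ms a≤
  ... | as , bs , refl , eq , total = spill v ∷ as , bs , refl , eq , total
  split-loads (suc a) (compute v ∷ ms) a≤ with split-loads (suc a) ms a≤
  ... | as , bs , refl , eq , total = compute v ∷ as , bs , refl , eq , total
  split-loads (suc a) (load v ∷ ms) (s≤s a≤) with split-loads a ms a≤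
  ... | as , bs , refl , eq , total = load v ∷ as , bs , refl , cong suc eq , cong suc total

  loaded : List (Move V) → List V
  loaded []               = []
  loaded (spill _ ∷ ms)   = loaded ms
  loaded (compute _ ∷ ms) = loaded ms
  loaded (load v ∷ ms)    = v ∷ loaded ms

  length-loaded : ∀ ms → length (loaded ms) ≡ loads ms
  length-loaded []               = refl
  length-loaded (spill _ ∷ ms)   = length-loaded ms
  length-loaded (compute _ ∷ ms) = length-loaded ms
  length-loaded (load v ∷ ms)    = cong suc (length-loaded ms)

  -- When `v` is computed, `u` is red. That pebble was there at the start, or came from a load in
  -- `ms`, or from computing `u` in `ms`, which requires that `u` was not white.
  operand-available : ∀ {S} ms {c u v} → LegalRun S c ms → white (run c ms) v → ¬ white c v → u ⇒ v →
                      red c u ⊎ u ∈ loaded ms ⊎ ¬ white c u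
  operand-available [] _ w ¬w _ = ⊥-elim (¬w w)
  operand-available (spill x ∷ ms) (_ , _ , legal) w ¬w e with operand-available ms legal w ¬w e
  ... | inj₁ (r , _) = inj₁ r
  ... | inj₂ other   = inj₂ other
  operand-available (load x ∷ ms) (_ , _ , legal) w ¬w e with operand-available ms legal w ¬w e
  ... | inj₁ (inj₁ r)      = inj₁ r
  ... | inj₁ (inj₂ refl)   = inj₂ (inj₁ (here refl))
  ... | inj₂ (inj₁ u∈)     = inj₂ (inj₁ (there u∈))
  ... | inj₂ (inj₂ ¬wu)    = inj₂ (inj₂ ¬wu)
  operand-available (compute x ∷ ms) {v = v} ((¬wx , preds) , _ , legal) w ¬w e with v ≟ x
  -- The first move computes `v` itself, so its operands are red already in `c`.
  ... | yes refl = inj₁ (preds _ e)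
  ... | no v≢x with operand-available ms legal w (λ { (inj₁ wv) → ¬w wv ; (inj₂ eq) → v≢x eq }) e
  ... | inj₁ (inj₁ r)      = inj₁ r
  -- Here `u` is the node just computed, so it was not white in `c`.
  ... | inj₁ (inj₂ refl)   = inj₂ (inj₂ ¬wx)
  ... | inj₂ (inj₁ u∈)     = inj₂ (inj₁ u∈)
  ... | inj₂ (inj₂ ¬wu)    = inj₂ (inj₂ (¬wu ∘ inj₁))

-- Decidable equality of the Gram-Schmidt nodes

Code : Set
Code = ℕ × ℕ × ℕ × ℕ

encode : MGSNode → Code
encode (inA i j)    = 0 , i , j , 0
encode (nrm0 k)     = 1 , k , 0 , 0
encode (nrmAcc k i) = 2 , k , i , 0
encode (rDiag k)    = 3 , k , 0 , 0
encode (qDiv k i)   = 4 , k , i , 0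
encode (r0 k j)     = 5 , k , j , 0
encode (rAcc k j i) = 6 , k , j , i
encode (aUpd k j i) = 7 , k , j , i

decode : Code → MGSNode
decode (0 , i , j , _) = inA i j
decode (1 , k , _ , _) = nrm0 k
decode (2 , k , i , _) = nrmAcc k i
decode (3 , k , _ , _) = rDiag k
decode (4 , k , i , _) = qDiv k i
decode (5 , k , j , _) = r0 k j
decode (6 , k , j , i) = rAcc k j i
decode (_ , k , j , i) = aUpd k j i

decode-encode : ∀ n → decode (encode n) ≡ n
decode-encode (inA i j)    = refl
decode-encode (nrm0 k)     = refl
decode-encode (nrmAcc k i) = refl
decode-encode (rDiag k)    = refl
decode-encode (qDiv k i)   = refl
decode-encode (r0 k j)     = refl
decode-encode (rAcc k j i) = refl
decode-encode (aUpd k j i) = refl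

_≟Node_ : DecidableEquality MGSNode
m ≟Node n = map′ injective (cong encode) (≡-dec _≟_ (≡-dec _≟_ (≡-dec _≟_ _≟_)) (encode m) (encode n))
  where
  injective : encode m ≡ encode n → m ≡ n
  injective eq = trans (sym (decode-encode m)) (trans (cong decode eq) (decode-encode n))

-- Vertices of `MGS M N` carry a validity proof; its uniqueness lets them be compared as bare nodes.
valid-irrelevant : ∀ {M N} n (p q : MGSValid M N n) → p ≡ q
valid-irrelevant (inA i j)    (a , b) (c , d) = cong₂ _,_ (<-irrelevant a c) (<-irrelevant b d)
valid-irrelevant (nrm0 k)     = <-irrelevant
valid-irrelevant (nrmAcc k i) (a , b) (c , d) = cong₂ _,_ (<-irrelevant a c) (<-irrelevant b d)
valid-irrelevant (rDiag k)    = <-irrelevant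
valid-irrelevant (qDiv k i)   (a , b) (c , d) = cong₂ _,_ (<-irrelevant a c) (<-irrelevant b d)
valid-irrelevant (r0 k j)     (a , b) (c , d) = cong₂ _,_ (<-irrelevant a c) (<-irrelevant b d)
valid-irrelevant (rAcc k j i) (a , b , x) (c , d , y) =
  cong₂ _,_ (<-irrelevant a c) (cong₂ _,_ (<-irrelevant b d) (<-irrelevant x y))
valid-irrelevant (aUpd k j i) (a , b , x) (c , d , y) =
  cong₂ _,_ (<-irrelevant a c) (cong₂ _,_ (<-irrelevant b d) (<-irrelevant x y))

_≟V_ : ∀ {M N} → DecidableEquality (CDAG.V (MGS M N))
(m , p) ≟V (n , q) with m ≟Node n
... | yes refl = yes (cong (m ,_) (valid-irrelevant m p q))
... | no  m≢n  = no (m≢n ∘ cong proj₁)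

isInput? : Decidable IsInputNode
isInput? (inA _ _)    = yes tt
isInput? (nrm0 _)     = no id
isInput? (nrmAcc _ _) = no id
isInput? (rDiag _)    = no id
isInput? (qDiv _ _)   = no id
isInput? (r0 _ _)     = no id
isInput? (rAcc _ _ _) = no id
isInput? (aUpd _ _ _) = no id

input-has-no-operand : ∀ {M u v} → IsInputNode v → ¬ MGSEdge M u v
input-has-no-operand {v = inA _ _} tt ()

_∈?_ : (p : ℕ × ℕ) (ps : List (ℕ × ℕ)) → Dec (p ∈ ps)
_∈?_ = DecMembership._∈?_ (≡-dec _≟_ _≟_)

-- The (column , row) of the input matrix to which a node is charged; q(k,i)
-- overwrites column k.  The remaining nodes are never charged.
entry : MGSNode → ℕ × ℕ
entry (inA i j)    = j , i
entry (qDiv k i)   = k , i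
entry (aUpd k j i) = j , i
entry _            = 0 , 0

entry-curA : ∀ k i j → entry (curA k i j) ≡ (j , i)
entry-curA zero    i j = refl
entry-curA (suc k) i j = refl

-- The hourglass and the growth within one segment

module _ {M N : ℕ} (1≤M : 1 ≤ M) where

  M-1<M : M ∸ 1 < M
  M-1<M = ∸-monoʳ-< z<s 1≤M

  -- Abstracts the white nodes of a sound configuration.
  record Closed (W : MGSNode → Set) : Set where
    field
      valid  : ∀ {n} → W n → MGSValid M N n
      closed : ∀ {m n} → MGSEdge M m n → MGSValid M N m → W n → W m
  open Closed

  rAcc-prefix : ∀ {W} → Closed W → ∀ {k j n i} → i ≤ n → W (rAcc k j n) → W (rAcc k j i)
  rAcc-prefix {W} C {k} {j} = downward step
    where
    step : ∀ i → W (rAcc k j (suc i)) → W (rAcc k j i)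
    step i w with valid C w
    ... | k<j , j<N , i<M = closed C racc-prev (k<j , j<N , <-trans (n<1+n i) i<M) w

  -- The hourglass: through r(k+1,j), every a(k+1,j,·) depends on the whole of a(k,j,·).
  hourglass : ∀ {W} → Closed W → ∀ {k j i i′} → i′ < M → W (aUpd (suc k) j i) → W (aUpd k j i′)
  hourglass C i′<M w with valid C w
  ... | k<j , j<N , i<M =
    closed C racc-A (<-trans (n<1+n _) k<j , j<N , i′<M)
      (rAcc-prefix C (≤-pred (≤-trans i′<M (≤-reflexive (sym (m+[n∸m]≡n 1≤M)))))
        (closed C upd-R (k<j , j<N , M-1<M) w))

  -- The hourglass in row `i` itself: for a fixed entry the updates in `W` are downward closed in
  -- `k`, as `<height⇒P` requires.
  aUpd-prev : ∀ {W} → Closed W → ∀ {j i} k → W (aUpd (suc k) j i) → W (aUpd k j i)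
  aUpd-prev C k w = hourglass C (proj₂ (proj₂ (valid C w))) w

  -- `W₀` and `W₁` are the nodes white before and after the segment, so E is `W₁` without `W₀`; `H`
  -- collects the entries of the nodes that are red at the start or loaded.
  module Segment {W₀ W₁ : MGSNode → Set} (C₀ : Closed W₀) (C₁ : Closed W₁)
                 (inputs : ∀ {i j} → i < M → j < N → W₀ (inA i j))
                 (H : List (ℕ × ℕ))
                 (available : ∀ {m n} → MGSEdge M m n → MGSValid M N m → W₁ n → ¬ W₀ n →
                              entry m ∈ H ⊎ ¬ W₀ m) where

    curA-valid : ∀ k {i j} → k ≤ j → j < N → i < M → MGSValid M N (curA k i j)
    curA-valid zero    _   j<N i<M = i<M , j<N
    curA-valid (suc k) k<j j<N i<M = k<j , j<N , i<M

    curA-charged : ∀ k {i j n} → k ≤ j → j < N → i < M → MGSEdge M (curA k i j) n →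
                   W₁ n → ¬ W₀ n → (j , i) ∈ H
    curA-charged k {i} {j} k≤j j<N i<M e w₁ ¬w₀ with available e (curA-valid k k≤j j<N i<M) w₁ ¬w₀
    ... | inj₁ charged = subst (_∈ H) (entry-curA k i j) charged
    curA-charged zero    _   j<N i<M e w₁ ¬w₀ | inj₂ new = ⊥-elim (new (inputs i<M j<N))
    curA-charged (suc k) k<j j<N i<M e w₁ ¬w₀ | inj₂ new =
      curA-charged k (<⇒≤ k<j) j<N i<M upd-A (closed C₁ e (k<j , j<N , i<M) w₁) new

    aUpd-charges-column-j : ∀ {k j i} → W₁ (aUpd k j i) → ¬ W₀ (aUpd k j i) → (j , i) ∈ H
    aUpd-charges-column-j {k} w₁ ¬w₀ with valid C₁ w₁
    ... | k<j , j<N , i<M = curA-charged k (<⇒≤ k<j) j<N i<M upd-A w₁ ¬w₀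

    -- The operand `qDiv k i` is charged directly to this entry, or it is new and its own operand
    -- `curA k i k` is charged there.
    aUpd-charges-column-k : ∀ {k j i} → W₁ (aUpd k j i) → ¬ W₀ (aUpd k j i) → (k , i) ∈ H
    aUpd-charges-column-k {k} w₁ ¬w₀ with valid C₁ w₁
    ... | k<j , j<N , i<M with available upd-Q (<-trans k<j j<N , i<M) w₁ ¬w₀
    ... | inj₁ charged = charged
    ... | inj₂ new     = curA-charged k ≤-refl (<-trans k<j j<N) i<M q-A
                           (closed C₁ upd-Q (<-trans k<j j<N , i<M) w₁) new

    Full : ℕ → Set
    Full c = All (λ i → (c , i) ∈ H) (upTo M)

    full? : Decidable Full
    full? c = All.all? (λ i → (c , i) ∈? H) (upTo M)

    fullColumns : List ℕ
    fullColumns = filter full? (upTo N)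

    -- Distinct full columns share no entry, and each has `M` of them in `H`.
    M*#full≤#H : M * length fullColumns ≤ length H
    M*#full≤#H = begin
      M * length fullColumns                     ≡⟨ *-comm M _ ⟩
      length fullColumns * M                     ≡⟨ cong (length fullColumns *_) (sym (length-upTo M)) ⟩
      length fullColumns * length (upTo M)       ≡⟨ sym (length-cartesianProduct fullColumns (upTo M)) ⟩
      length (cartesianProduct fullColumns (upTo M))
        ≤⟨ unique-⊆⇒length≤ (Unique.cartesianProduct⁺ (Unique.filter⁺ full? (Unique.upTo⁺ N)) (Unique.upTo⁺ M)) charged ⟩
      length H                                   ∎
      where
      open ≤-Reasoning
      charged : ∀ {p} → p ∈ cartesianProduct fullColumns (upTo M) → p ∈ H
      charged p∈ with ∈-cartesianProduct⁻ fullColumns (upTo M) p∈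
      ... | c∈ , i∈ = All.lookup (proj₂ (∈-filter⁻ full? {xs = upTo N} c∈)) i∈

    -- The hourglass is used twice: in `W₁` it descends from iteration `k + 2` to all rows of
    -- iteration `k + 1`; in `W₀` any row of iteration `k + 1` would force `aUpd k j i`.
    interior-new : ∀ {k j i i′} → i′ < M → ¬ W₀ (aUpd k j i) → W₁ (aUpd (suc (suc k)) j i) →
                   W₁ (aUpd (suc k) j i′) × ¬ W₀ (aUpd (suc k) j i′)
    interior-new {i = i} i′<M ¬w₀ w₁ =
      hourglass C₁ i′<M w₁ , λ w₀ → ¬w₀ (hourglass C₀ (proj₂ (proj₂ (valid C₁ w₁))) w₀)

    -- Each of the `M` new updates of iteration `k + 1` charges column `k + 1` through `Q` and
    -- column `j` through `A`.
    interior-full : ∀ {k j i} → ¬ W₀ (aUpd k j i) → W₁ (aUpd (suc (suc k)) j i) →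
                    suc k ∈ fullColumns × j ∈ fullColumns
    interior-full {k} {j} {i} ¬w₀ w₁ with valid C₁ w₁
    ... | k<j , j<N , _ =
      ∈-filter⁺ full? (∈-upTo⁺ (<-trans (<-trans (n<1+n _) k<j) j<N))
        (All.tabulate λ i∈ → let w , ¬w = interior-new (∈-upTo⁻ i∈) ¬w₀ w₁ in aUpd-charges-column-k w ¬w) ,
      ∈-filter⁺ full? (∈-upTo⁺ j<N)
        (All.tabulate λ i∈ → let w , ¬w = interior-new (∈-upTo⁻ i∈) ¬w₀ w₁ in aUpd-charges-column-j w ¬w)

    module _ (W₀? : ∀ j i → Decidable (λ k → W₀ (aUpd k j i)))
             (W₁? : ∀ j i → Decidable (λ k → W₁ (aUpd k j i))) where

      -- The updates of an entry `p` in E are those with `h₀ p ≤ k < h₁ p`.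
      h₀ h₁ : ℕ × ℕ → ℕ
      h₀ (j , i) = height (W₀? j i) j
      h₁ (j , i) = height (W₁? j i) j

      below-h₁ : ∀ {j i k} → k < h₁ (j , i) → W₁ (aUpd k j i)
      below-h₁ {j} {i} = <height⇒P (W₁? j i) (aUpd-prev C₁) {j}

      above-h₀ : ∀ {j i k} → k < j → h₀ (j , i) ≤ k → ¬ W₀ (aUpd k j i)
      above-h₀ {j} {i} k<j h≤k w = <⇒≱ (<height (W₀? j i) k<j w) h≤k

      -- Of `n > 2` new updates, the `n - 2` interior ones give distinct full columns `k < j`, and
      -- `j` is one more; hence `n - 1` is at most the number of full columns.
      growth : ∀ p → h₁ p ≤ h₀ p + (2 + (length fullColumns ∸ 1))
      growth p@(j , i) with h₁ p ≤? h₀ p + 2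
      ... | yes small = ≤-trans small (+-monoʳ-≤ (h₀ p) (m≤m+n 2 _))
      ... | no large with m≤n⇒∃[o]m+o≡n (≰⇒> large)
      ... | d , eq = begin
        h₁ p                                    ≡⟨ sym eq ⟩
        suc (h₀ p + 2) + d                      ≡⟨ rearrange (h₀ p) d ⟩
        h₀ p + (2 + suc d)                      ≤⟨ +-monoʳ-≤ (h₀ p) (+-monoʳ-≤ 2 (∸-monoˡ-≤ 1 2+d≤#full)) ⟩
        h₀ p + (2 + (length fullColumns ∸ 1))   ∎
        where
        open ≤-Reasoning
        rearrange : ∀ a d → suc (a + 2) + d ≡ a + (2 + suc d)
        rearrange = solve-∀
        rearrange′ : ∀ a d → suc (a + 2) + d ≡ suc (suc (suc (a + d)))
        rearrange′ = solve-∀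
        -- As `h₁ p = h₀ p + 3 + d`, the interior indices are `h₀ p + 1 + t` for `t ≤ d`; the two
        -- neighbours of each supply the hypotheses of `interior-full`.
        interior : ∀ {t} → t < suc d → ¬ W₀ (aUpd (h₀ p + t) j i) × W₁ (aUpd (suc (suc (h₀ p + t))) j i)
        interior {t} t≤d = above-h₀ (<-trans (<-trans (n<1+n _) (n<1+n _)) (proj₁ (valid C₁ w₁))) (m≤m+n _ t) , w₁
          where
          w₁ = below-h₁ (≤-trans (s≤s (s≤s (s≤s (+-monoʳ-≤ (h₀ p) (≤-pred t≤d)))))
                 (≤-reflexive (trans (sym (rearrange′ (h₀ p) d)) eq)))
        step : ℕ → ℕ
        step t = suc (h₀ p + t)
        columns : List ℕ
        columns = j ∷ applyUpTo step (suc d)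
        columns⊆full : ∀ {c} → c ∈ columns → c ∈ fullColumns
        columns⊆full (here refl) = let ¬w₀ , w₁ = interior {0} z<s in proj₂ (interior-full ¬w₀ w₁)
        columns⊆full (there c∈) with ∈-applyUpTo⁻ step c∈
        ... | t , t<1+d , refl = let ¬w₀ , w₁ = interior t<1+d in proj₁ (interior-full ¬w₀ w₁)
        j∉ : ∀ {c} → c ∈ applyUpTo step (suc d) → j ≢ c
        j∉ c∈ j≡c with ∈-applyUpTo⁻ step c∈
        ... | t , t<1+d , c≡ =
          <⇒≢ (<-trans (n<1+n _) (proj₁ (valid C₁ (proj₂ (interior t<1+d))))) (sym (trans j≡c c≡))
        columns-unique : Unique columns
        columns-unique = All.tabulate j∉ ∷
          Unique.applyUpTo⁺₁ step (suc d) (λ i<j _ eq′ → <⇒≢ i<j (+-cancelˡ-≡ (h₀ p) _ _ (suc-injective eq′)))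
        2+d≤#full : suc (suc d) ≤ length fullColumns
        2+d≤#full = ≤-trans (≤-reflexive (cong suc (sym (length-applyUpTo step (suc d)))))
                      (unique-⊆⇒length≤ columns-unique columns⊆full)

      -- Otherwise the update with index `h₀ p` would be new and charge `p`.
      no-growth : ∀ p → ¬ p ∈ H → h₁ p ≤ h₀ p
      no-growth p@(j , i) p∉H with h₁ p ≤? h₀ p
      ... | yes le = le
      ... | no h₁≰h₀ = ⊥-elim (p∉H (aUpd-charges-column-j w₁ (above-h₀ (proj₁ (valid C₁ w₁)) ≤-refl)))
        where w₁ = below-h₁ (≰⇒> h₁≰h₀)

      total-growth : ∀ {ps} → Unique ps →
        sum (map h₁ ps) ≤ sum (map h₀ ps) + length H * (2 + (length fullColumns ∸ 1))
      total-growth {ps} uniq = ≤-trans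
        (sum-map-≤ (_∈? H) h₁ h₀ (2 + (length fullColumns ∸ 1)) ps (λ {p} _ → growth p) (λ {p} _ → no-growth p))
        (+-monoʳ-≤ (sum (map h₀ ps)) (*-monoˡ-≤ _
          (unique-⊆⇒length≤ (Unique.filter⁺ (_∈? H) uniq) (proj₂ ∘ ∈-filter⁻ (_∈? H) {xs = ps}))))

-- Adding up the segments of a game

module Accounting {M N : ℕ} (1≤M : 1 ≤ M) where
  open Game (MGS M N)
  open Pebbling (MGS M N) _≟V_ (isInput? ∘ proj₁) input-has-no-operand

  White : Config (CDAG.V (MGS M N)) → MGSNode → Set
  White c n = ∃ λ (p : MGSValid M N n) → white c (n , p)

  White⇒white : ∀ c {n} (p : MGSValid M N n) → White c n → white c (n , p)
  White⇒white c {n} p (q , w) = subst (λ p → white c (n , p)) (valid-irrelevant n q p) w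

  White-closed : ∀ {c} → Sound c → Closed 1≤M (White c)
  White-closed s = record { valid = proj₁ ; closed = λ { e p (_ , w) → p , white-closed s e w } }

  aUpd? : ∀ {c} → Sound c → ∀ j i → Decidable (λ k → White c (aUpd k j i))
  aUpd? {c} s j i k with (k <? j) ×-dec (j <? N) ×-dec (i <? M)
  ... | yes p = map′ (p ,_) (White⇒white c p) (white? s (aUpd k j i , p))
  ... | no ¬p = no (¬p ∘ proj₁)

  cells : List (ℕ × ℕ)
  cells = cartesianProduct (upTo N) (upTo M)

  cells-unique : Unique cells
  cells-unique = Unique.cartesianProduct⁺ (Unique.upTo⁺ N) (Unique.upTo⁺ M)

  updates : ∀ {c} → Sound c → ℕ × ℕ → ℕ
  updates s (j , i) = height (aUpd? s j i) j

  -- The potential of the argument: it counts the white updates, since those of one entry are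
  -- downward closed in `k`.
  progress : ∀ {c} → Sound c → ℕ
  progress s = sum (map (updates s) cells)

  progress-initial : progress initial-sound ≡ 0
  progress-initial = sum-map-zero (updates initial-sound) cells
    λ { (j , i) → height-empty (aUpd? initial-sound j i) (λ _ ()) j }

  -- At the end each entry of column `j` has all its `j` updates; doubling avoids a division.
  progress-complete : ∀ {c} (s : Sound c) → (∀ v → white c v) → M * (N * (N ∸ 1)) ≤ 2 * progress s
  progress-complete s all-white = begin
    M * (N * (N ∸ 1))                  ≡⟨ cong (M *_) (sym (2*sum-upTo N)) ⟩
    M * (2 * sum (upTo N))             ≡⟨ rearrange M (sum (upTo N)) ⟩
    2 * (sum (upTo N) * M)             ≡⟨ cong (λ m → 2 * (sum (upTo N) * m)) (sym (length-upTo M)) ⟩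
    2 * (sum (upTo N) * length (upTo M)) ≡⟨ cong (2 *_) (sym (sum-map-proj₁ (upTo N) (upTo M))) ⟩
    2 * sum (map proj₁ cells)          ≤⟨ *-monoʳ-≤ 2 (sum-map-mono proj₁ (updates s) cells column-done) ⟩
    2 * progress s                     ∎
    where
    open ≤-Reasoning
    rearrange : ∀ m a → m * (2 * a) ≡ 2 * (a * m)
    rearrange = solve-∀
    column-done : ∀ {p} → p ∈ cells → proj₁ p ≤ updates s p
    column-done {zero , i} _ = z≤n
    column-done {suc k , i} p∈ with ∈-cartesianProduct⁻ (upTo N) (upTo M) p∈
    ... | j∈ , i∈ = <height (aUpd? s (suc k) i) (n<1+n k) (valid , all-white (aUpd k (suc k) i , valid))
      where valid = n<1+n k , ∈-upTo⁻ j∈ , ∈-upTo⁻ i∈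

  -- Here `f` is the number of full columns. The equation for `c₁` spares transporting `s₁` when a
  -- run is split in two.
  segment-growth : ∀ {S c₀ c₁} ms reds (s₀ : Sound c₀) (s₁ : Sound c₁) → c₁ ≡ run c₀ ms →
    LegalRun S c₀ ms → (∀ v → red c₀ v → v ∈ reds) →
    let x = length reds + loads ms in
    ∃ λ f → M * f ≤ x × progress s₁ ≤ progress s₀ + x * (2 + (f ∸ 1))
  segment-growth {c₀ = c₀} ms reds s₀ s₁ refl legal reds-complete =
    length fullColumns ,
    subst (M * length fullColumns ≤_) length-H M*#full≤#H ,
    subst (λ x → progress s₁ ≤ progress s₀ + x * (2 + (length fullColumns ∸ 1))) length-H
      (total-growth (aUpd? s₀) (aUpd? s₁) cells-unique)
    where
    H : List (ℕ × ℕ)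
    H = map (entry ∘ proj₁) (reds ++ loaded ms)
    length-H : length H ≡ length reds + loads ms
    length-H = trans (length-map (entry ∘ proj₁) (reds ++ loaded ms))
                 (trans (length-++ reds) (cong (length reds +_) (length-loaded ms)))
    available : ∀ {m n} → MGSEdge M m n → MGSValid M N m → White (run c₀ ms) n → ¬ White c₀ n →
                entry m ∈ H ⊎ ¬ White c₀ m
    available e p (q , w₁) ¬w₀ with operand-available ms {u = _ , p} {v = _ , q} legal w₁ (¬w₀ ∘ (q ,_)) e
    ... | inj₁ r          = inj₁ (∈-map⁺ (entry ∘ proj₁) (∈-++⁺ˡ (reds-complete _ r)))
    ... | inj₂ (inj₁ u∈)  = inj₁ (∈-map⁺ (entry ∘ proj₁) (∈-++⁺ʳ reds u∈))
    ... | inj₂ (inj₂ ¬w)  = inj₂ (¬w ∘ White⇒white c₀ p)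
    open Segment 1≤M (White-closed s₀) (White-closed s₁)
      (λ i<M j<N → (i<M , j<N) , input-white s₀ tt) H available

  -- Induction on the number of loads, cutting off the last `T` while there are at least `2 * T`.
  -- The rate of `B / A` updates per load is checked in `first` for the segment left over, and in
  -- `later` for a segment of exactly `T` loads that starts with at most `S` reds.
  amortised : ∀ A B {S T} → 1 ≤ T →
    (∀ x f → x < 2 * T → M * f ≤ x → A * (x * (2 + (f ∸ 1))) ≤ B * x) →
    (∀ x f → x ≤ S + T → M * f ≤ x → A * (x * (2 + (f ∸ 1))) ≤ B * T) →
    ∀ {c} ms → LegalRun S initial ms → c ≡ run initial ms → (s : Sound c) → A * progress s ≤ B * loads ms
  amortised A B {S} {T} 1≤T first later ms = <-rec P rec (loads ms) ms refl
    where
    open ≤-Reasoning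
    P : ℕ → Set₁
    P L = ∀ ms → loads ms ≡ L → ∀ {c} → LegalRun S initial ms → c ≡ run initial ms →
          (s : Sound c) → A * progress s ≤ B * loads ms
    rec : ∀ L → (∀ {L′} → L′ < L → P L′) → P L
    rec L ih ms refl legal eq s with loads ms <? 2 * T
    -- No node is red initially, so all charges come from loads.
    ... | yes short with segment-growth ms [] initial-sound s eq legal (λ _ ())
    ... | f , full , grow rewrite progress-initial =
      ≤-trans (*-monoʳ-≤ A grow) (first (loads ms) f short full)
    rec L ih ms refl legal eq s | no long with split-loads (loads ms ∸ T) ms (m∸n≤m (loads ms) T)
    ... | as , bs , refl , loads-as , total with LegalRun-++⁻ as bs legal
    ... | legal-as , legal-bs with run-red as legal-as ([] , z≤n , λ _ ())
    ... | reds , few , complete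
      with segment-growth bs reds (run-sound as legal-as initial-sound) s (trans eq (run-++ as bs)) legal-bs complete
    ... | f , full , grow = begin
      A * progress s                                       ≤⟨ *-monoʳ-≤ A grow ⟩
      A * (progress s′ + x * (2 + (f ∸ 1)))                ≡⟨ *-distribˡ-+ A (progress s′) _ ⟩
      A * progress s′ + A * (x * (2 + (f ∸ 1)))            ≤⟨ +-mono-≤ (ih as<all as refl legal-as refl s′) (later x f x≤S+T full) ⟩
      B * loads as + B * T                                 ≡⟨ sym (*-distribˡ-+ B (loads as) T) ⟩
      B * (loads as + T)                                   ≡⟨ cong (B *_) as+T ⟩
      B * loads (as ++ bs)                                 ∎
      where
      s′ = run-sound as legal-as initial-sound
      x = length reds + loads bs
      T≤L : T ≤ loads (as ++ bs)
      T≤L = ≤-trans (m≤m+n T _) (≮⇒≥ long)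
      as+T : loads as + T ≡ loads (as ++ bs)
      as+T = trans (cong (_+ T) loads-as) (m∸n+n≡m T≤L)
      bs≡T : loads bs ≡ T
      bs≡T = +-cancelˡ-≡ (loads as) _ _ (trans total (sym as+T))
      x≤S+T : x ≤ S + T
      x≤S+T = +-mono-≤ few (≤-reflexive bs≡T)
      as<all : loads as < loads (as ++ bs)
      as<all = <-≤-trans (m<m+n (loads as) 1≤T) (≤-reflexive as+T)

  -- The two choices of segment length

  module _ {x f : ℕ} (M*f≤x : M * f ≤ x) where
    open ≤-Reasoning

    -- The factor `M` makes the unknown `f` disappear: `M * (f ∸ 1) ≤ M * f ≤ x`.
    growth-wide : M * (x * (2 + (f ∸ 1))) ≤ x * (2 * M + x)
    growth-wide = begin
      M * (x * (2 + (f ∸ 1)))         ≡⟨ rearrange M x (f ∸ 1) ⟩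
      x * (2 * M + M * (f ∸ 1))       ≤⟨ *-monoʳ-≤ x (+-monoʳ-≤ (2 * M) (≤-trans (*-monoʳ-≤ M (m∸n≤m f 1)) M*f≤x)) ⟩
      x * (2 * M + x)                 ∎
      where
      rearrange : ∀ m x g → m * (x * (2 + g)) ≡ x * (2 * m + m * g)
      rearrange = solve-∀

    -- Two full columns would already need `2 * M` charges, so `f ≤ 1` and the truncated `f ∸ 1`
    -- vanishes.
    growth-narrow : x < 2 * M → x * (2 + (f ∸ 1)) ≡ x * 2
    growth-narrow x<2M with f ≤? 1
    ... | yes f≤1 = cong (λ g → x * (2 + g)) (m≤n⇒m∸n≡0 f≤1)
    ... | no f≰1  = ⊥-elim (<⇒≱ x<2M (≤-trans (≤-trans (≤-reflexive (*-comm 2 M)) (*-monoʳ-≤ M (≰⇒> f≰1))) M*f≤x))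

  -- With `T = S` a later segment has `x ≤ 2 * S`, and `2S (2M + 2S)` is exactly `4 (S + M) T`.
  wide-bound : ∀ {S ms} → 1 ≤ S → LegalRun S initial ms → (s : Sound (run initial ms)) →
               M * progress s ≤ 4 * (S + M) * loads ms
  wide-bound {S} {ms} 1≤S legal s = amortised M (4 * (S + M)) 1≤S first later ms legal refl s
    where
    open ≤-Reasoning
    first : ∀ x f → x < 2 * S → M * f ≤ x → M * (x * (2 + (f ∸ 1))) ≤ 4 * (S + M) * x
    first x f x<2S M*f≤x = begin
      M * (x * (2 + (f ∸ 1)))                      ≤⟨ growth-wide M*f≤x ⟩
      x * (2 * M + x)                              ≤⟨ *-monoʳ-≤ x (+-monoʳ-≤ (2 * M) (<⇒≤ x<2S)) ⟩
      -- The first segment needs only half of the constant, so a second copy is added.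
      x * (2 * M + 2 * S)                          ≤⟨ m≤m+n _ _ ⟩
      x * (2 * M + 2 * S) + x * (2 * M + 2 * S)    ≡⟨ rearrange M S x ⟩
      4 * (S + M) * x                              ∎
      where
      rearrange : ∀ m s x → x * (2 * m + 2 * s) + x * (2 * m + 2 * s) ≡ 4 * (s + m) * x
      rearrange = solve-∀
    later : ∀ x f → x ≤ S + S → M * f ≤ x → M * (x * (2 + (f ∸ 1))) ≤ 4 * (S + M) * S
    later x f x≤2S M*f≤x = begin
      M * (x * (2 + (f ∸ 1)))        ≤⟨ growth-wide M*f≤x ⟩
      x * (2 * M + x)                ≤⟨ *-mono-≤ x≤2S (+-monoʳ-≤ (2 * M) x≤2S) ⟩
      (S + S) * (2 * M + (S + S))    ≡⟨ rearrange M S ⟩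
      4 * (S + M) * S                ∎
      where
      rearrange : ∀ m s → (s + s) * (2 * m + (s + s)) ≡ 4 * (s + m) * s
      rearrange = solve-∀

  -- With `T = M ∸ S` a later segment has `x ≤ S + T = M`, and the first has `x < 2 * M`, so
  -- `growth-narrow` allows at most `2 * x` updates in both.
  narrow-bound : ∀ {S ms} → S ≤ M → LegalRun S initial ms → (s : Sound (run initial ms)) →
                 (M ∸ S) * progress s ≤ 2 * M * loads ms
  narrow-bound {S} {ms} S≤M legal s with 1 ≤? M ∸ S
  -- For `S = M` there is no admissible segment length, but the left-hand side is zero.
  ... | no M∸S≤0 = subst (λ d → d * progress s ≤ 2 * M * loads ms) (sym (n<1⇒n≡0 (≰⇒> M∸S≤0))) z≤n
  ... | yes 1≤M∸S = amortised (M ∸ S) (2 * M) 1≤M∸S first later ms legal refl s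
    where
    open ≤-Reasoning
    rearrange : ∀ a x → a * (x * 2) ≡ 2 * a * x
    rearrange = solve-∀
    first : ∀ x f → x < 2 * (M ∸ S) → M * f ≤ x → (M ∸ S) * (x * (2 + (f ∸ 1))) ≤ 2 * M * x
    first x f x<2T M*f≤x = begin
      (M ∸ S) * (x * (2 + (f ∸ 1)))
        ≡⟨ cong ((M ∸ S) *_) (growth-narrow M*f≤x (<-≤-trans x<2T (*-monoʳ-≤ 2 (m∸n≤m M S)))) ⟩
      (M ∸ S) * (x * 2)   ≤⟨ *-monoˡ-≤ (x * 2) (m∸n≤m M S) ⟩
      M * (x * 2)         ≡⟨ rearrange M x ⟩
      2 * M * x           ∎
    later : ∀ x f → x ≤ S + (M ∸ S) → M * f ≤ x → (M ∸ S) * (x * (2 + (f ∸ 1))) ≤ 2 * M * (M ∸ S)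
    later x f x≤S+T M*f≤x = begin
      (M ∸ S) * (x * (2 + (f ∸ 1)))
        ≡⟨ cong ((M ∸ S) *_) (growth-narrow M*f≤x (≤-<-trans x≤M (m<m+n M (<-≤-trans 1≤M (m≤m+n M 0))))) ⟩
      (M ∸ S) * (x * 2)   ≤⟨ *-monoʳ-≤ (M ∸ S) (*-monoˡ-≤ 2 x≤M) ⟩
      (M ∸ S) * (M * 2)   ≡⟨ *-comm (M ∸ S) (M * 2) ⟩
      M * 2 * (M ∸ S)     ≡⟨ cong (_* (M ∸ S)) (*-comm M 2) ⟩
      2 * M * (M ∸ S)     ∎
      where
      x≤M : x ≤ M
      x≤M = ≤-trans x≤S+T (≤-reflexive (m+[n∸m]≡n S≤M))

  complete-bound : ∀ A B {S ms} → CompleteGame S ms →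
                   (LegalRun S initial ms → (s : Sound (run initial ms)) → A * progress s ≤ B * loads ms) →
                   A * (M * (N * (N ∸ 1))) ≤ 2 * (B * loads ms)
  complete-bound A B {S} {ms} (legal , all-white) bound = begin
    A * (M * (N * (N ∸ 1)))   ≤⟨ *-monoʳ-≤ A (progress-complete s all-white) ⟩
    A * (2 * progress s)      ≡⟨ rearrange A (progress s) ⟩
    2 * (A * progress s)      ≤⟨ *-monoʳ-≤ 2 (bound legal s) ⟩
    2 * (B * loads ms)        ∎
    where
    open ≤-Reasoning
    s = run-sound ms legal initial-sound
    rearrange : ∀ a p → a * (2 * p) ≡ 2 * (a * p)
    rearrange = solve-∀

theorem3 : (M N S : ℕ) → 1 ≤ M → 1 ≤ N → 1 ≤ S →
    (ms : List (Move (CDAG.V (MGS M N)))) → Game.CompleteGame (MGS M N) S ms →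
    (M * M * N * (N ∸ 1) ≤ 8 * (S + M) * Game.loads (MGS M N) ms)
    × (S ≤ M → (M ∸ S) * N * (N ∸ 1) ≤ 4 * Game.loads (MGS M N) ms)
theorem3 M@(suc _) N S 1≤M 1≤N 1≤S ms game = wide , narrow
  where
  open Game (MGS M N) using (loads)
  open Accounting {M} {N} 1≤M
  open ≤-Reasoning
  wide : M * M * N * (N ∸ 1) ≤ 8 * (S + M) * loads ms
  wide = begin
    M * M * N * (N ∸ 1)             ≡⟨ lhs M N (N ∸ 1) ⟩
    M * (M * (N * (N ∸ 1)))         ≤⟨ complete-bound M (4 * (S + M)) game (wide-bound 1≤S) ⟩
    2 * (4 * (S + M) * loads ms)    ≡⟨ rhs (S + M) (loads ms) ⟩
    8 * (S + M) * loads ms          ∎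
    where
    lhs : ∀ m n p → m * m * n * p ≡ m * (m * (n * p))
    lhs = solve-∀
    rhs : ∀ a l → 2 * (4 * a * l) ≡ 8 * a * l
    rhs = solve-∀
  narrow : S ≤ M → (M ∸ S) * N * (N ∸ 1) ≤ 4 * loads ms
  -- The number of updates and the rate both carry a factor `M`, which cancels; the match on
  -- `M@(suc _)` makes it visibly nonzero.
  narrow S≤M = *-cancelˡ-≤ M (begin
    M * ((M ∸ S) * N * (N ∸ 1))     ≡⟨ lhs M (M ∸ S) N (N ∸ 1) ⟩
    (M ∸ S) * (M * (N * (N ∸ 1)))   ≤⟨ complete-bound (M ∸ S) (2 * M) game (narrow-bound S≤M) ⟩
    2 * (2 * M * loads ms)          ≡⟨ rhs M (loads ms) ⟩
    M * (4 * loads ms)              ∎)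
    where
    lhs : ∀ m d n p → m * (d * n * p) ≡ d * (m * (n * p))
    lhs = solve-∀
    rhs : ∀ m l → 2 * (2 * m * l) ≡ m * (4 * l)
    rhs = solve-∀
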